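{- Let $(M,\leq,\odot,\rightarrow,\bot,\top)$ be a complete residuated multilattice. For any reflexive $M$-fuzzy approximation space $(X,R)$ the following properties hold: (i) $\underline{R}(\Downarrow)=\Downarrow$; (ii) $\overline{R}(\Uparrow)=\Uparrow$.
   Context: For a subset $S$ of a poset $(P,\leq)$, $\sqcup S$ is the set of minimal elements of the set of upper bounds of $S$, and $\sqcap S$ is the set of maximal elements of the set of lower bounds of $S$. A poset $(M,\leq)$ is a multilattice if for all $a,b,x\in M$: $a,b\leq x$ implies there is $z\in\sqcup\{a,b\}$ with $z\leq x$, and $a,b\geq x$ implies there is $z\in\sqcap\{a,b\}$ with $z\geq x$. It is a complete multilattice if moreover $\sqcup S$ and $\sqcap S$ are nonempty for every $S\subseteq M$. A pocrim is a structure $(A,\leq,\odot,\rightarrow,\top)$ where $(A,\leq)$ is a poset with top element $\top$, $(A,\odot,\top)$ is a commutative monoid with neutral element $\top$, and $a\odot b\leq c\iff a\leq b\rightarrow c$ for all $a,b,c\in A$. A complete residuated multilattice $(M,\leq,\odot,\rightarrow,\bot,\top)$ is a pocrim with bottom element $\bot$ whose underlying poset is a complete multilattice. An $M$-fuzzy approximation space is a pair $(X,R)$ with $X$ a nonempty set and $R:X\times X\to M$ (a binary $M$-fuzzy relation). $M^X$ is the set of all maps $X\to M$ ($M$-fuzzy sets), ordered pointwise; $\Uparrow,\Downarrow\in M^X$ are the constant maps with values $\top$ and $\bot$ respectively. For $f\in M^X$ and $x\in X$, $$\underline{R}(f)(x):=\bigwedge_{y\in X}(R(x,y)\rightarrow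 f(y)),\qquad \overline{R}(f)(x):=\bigvee_{y\in X}(R(x,y)\odot f(y)),$$ where $\bigwedge$ and $\bigvee$ denote infimum and supremum in $M$ (the paper asserts that these exist for every complete residuated multilattice). $(X,R)$ is reflexive if $R(x,x)=\top$ for every $x\in X$. -}

module Defs where

open import Algebra.Structures using (IsCommutativeMonoid)
open import Data.Product.Base using (_×_; _,_; ∃-syntax)
open import Data.Sum.Base using (_⊎_)
open import Function.Bundles using (_⇔_)
open import Level using (Level; _⊔_; suc)
open import Relation.Binary.Bundles using (Poset)
open import Relation.Binary.Core using (Rel)
open import Relation.Binary.Definitions using (Maximum; Minimum)
open import Relation.Unary using (Pred; _∈_; Satisfiable)

private
  variable
    a r s : Level

module _ {c ℓ₁ ℓ₂} (P : Poset c ℓ₁ ℓ₂) where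

  open Poset P

  UpperBounds : Pred Carrier s → Pred Carrier (c ⊔ ℓ₂ ⊔ s)
  UpperBounds S u = ∀ {x} → x ∈ S → x ≤ u

  LowerBounds : Pred Carrier s → Pred Carrier (c ⊔ ℓ₂ ⊔ s)
  LowerBounds S l = ∀ {x} → x ∈ S → l ≤ x

  MinimalElements : Pred Carrier s → Pred Carrier (c ⊔ ℓ₁ ⊔ ℓ₂ ⊔ s)
  MinimalElements S m = m ∈ S × (∀ {x} → x ∈ S → x ≤ m → x ≈ m)

  MaximalElements : Pred Carrier s → Pred Carrier (c ⊔ ℓ₁ ⊔ ℓ₂ ⊔ s)
  MaximalElements S m = m ∈ S × (∀ {x} → x ∈ S → m ≤ x → x ≈ m)

  -- The sets written ⊔S and ⊓S for a subset S.
  Multisuprema : Pred Carrier s → Pred Carrier (c ⊔ ℓ₁ ⊔ ℓ₂ ⊔ s)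
  Multisuprema S = MinimalElements (UpperBounds S)

  Multiinfima : Pred Carrier s → Pred Carrier (c ⊔ ℓ₁ ⊔ ℓ₂ ⊔ s)
  Multiinfima S = MaximalElements (LowerBounds S)

  pair : Carrier → Carrier → Pred Carrier ℓ₁
  pair a b x = x ≈ a ⊎ x ≈ b

  record IsMultilattice : Set (c ⊔ ℓ₁ ⊔ ℓ₂) where
    field
      multisup : ∀ a b x → a ≤ x → b ≤ x →
                 ∃[ z ] (z ∈ Multisuprema (pair a b) × z ≤ x)
      multiinf : ∀ a b x → x ≤ a → x ≤ b →
                 ∃[ z ] (z ∈ Multiinfima (pair a b) × x ≤ z)

  -- Subsets are predicates, so "every S ⊆ M" ranges over the predicates
  -- valued in Set s, for a universe level s that is a parameter.
  record IsCompleteMultilattice (s : Level) : Set (c ⊔ ℓ₁ ⊔ ℓ₂ ⊔ suc s) where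
    field
      isMultilattice        : IsMultilattice
      multisuprema-nonempty : (S : Pred Carrier s) → Satisfiable (Multisuprema S)
      multiinfima-nonempty  : (S : Pred Carrier s) → Satisfiable (Multiinfima S)

    open IsMultilattice isMultilattice public

  IsSupremum : Pred Carrier s → Pred Carrier (c ⊔ ℓ₂ ⊔ s)
  IsSupremum S m = m ∈ UpperBounds S × (∀ {u} → u ∈ UpperBounds S → m ≤ u)

  IsInfimum : Pred Carrier s → Pred Carrier (c ⊔ ℓ₂ ⊔ s)
  IsInfimum S m = m ∈ LowerBounds S × (∀ {l} → l ∈ LowerBounds S → l ≤ m)

  supremum-unique : ∀ {S : Pred Carrier s} {m n} →
                    IsSupremum S m → IsSupremum S n → m ≈ n
  supremum-unique (m-ub , m-least) (n-ub , n-least) =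
    antisym (m-least n-ub) (n-least m-ub)

  infimum-unique : ∀ {S : Pred Carrier s} {m n} →
                   IsInfimum S m → IsInfimum S n → m ≈ n
  infimum-unique (m-lb , m-greatest) (n-lb , n-greatest) =
    antisym (n-greatest m-lb) (m-greatest n-lb)

  range : {X : Set a} → (X → Carrier) → Pred Carrier (a ⊔ ℓ₁)
  range F z = ∃[ y ] z ≈ F y

record Pocrim (c ℓ₁ ℓ₂ : Level) : Set (suc (c ⊔ ℓ₁ ⊔ ℓ₂)) where
  field
    poset : Poset c ℓ₁ ℓ₂

  open Poset poset public

  infixl 7 _⊙_
  infixr 6 _⇒_

  field
    _⊙_                 : Carrier → Carrier → Carrier
    _⇒_                 : Carrier → Carrier → Carrier
    ⊤                   : Carrier
    maximum             : Maximum _≤_ ⊤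
    isCommutativeMonoid : IsCommutativeMonoid _≈_ _⊙_ ⊤
    residuated          : ∀ a b c → (a ⊙ b ≤ c) ⇔ (a ≤ b ⇒ c)

record CompleteResiduatedMultilattice (c ℓ₁ ℓ₂ s : Level)
       : Set (suc (c ⊔ ℓ₁ ⊔ ℓ₂ ⊔ s)) where
  field
    pocrim : Pocrim c ℓ₁ ℓ₂

  open Pocrim pocrim public

  field
    ⊥                      : Carrier
    minimum                : Minimum _≤_ ⊥
    isCompleteMultilattice : IsCompleteMultilattice poset s

module _ {c ℓ₁ ℓ₂ s} (M : CompleteResiduatedMultilattice c ℓ₁ ℓ₂ s) where

  open CompleteResiduatedMultilattice M

  record FuzzyApproximationSpace (a : Level) : Set (c ⊔ suc a) where
    field
      X        : Set a
      nonempty : X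
      R        : X → X → Carrier

  FuzzySet : Set a → Set (c ⊔ a)
  FuzzySet X = X → Carrier

  ⇑ : {X : Set a} → FuzzySet X
  ⇑ _ = ⊤

  ⇓ : {X : Set a} → FuzzySet X
  ⇓ _ = ⊥

  module _ (𝒳 : FuzzyApproximationSpace a) where

    open FuzzyApproximationSpace 𝒳

    IsReflexive : Set (ℓ₁ ⊔ a)
    IsReflexive = ∀ x → R x x ≈ ⊤

    -- LowerApproximation f g says that the lower approximation of f is defined
    -- and equal to g: every infimum in its formula exists and has value g x.
    -- A relation is used because the completeness axioms only provide
    -- multi-infima and multi-suprema, so these infima and suprema need not
    -- exist for arbitrary f.
    LowerApproximation : Rel (FuzzySet X) (c ⊔ ℓ₁ ⊔ ℓ₂ ⊔ a)
    LowerApproximation f g =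
      ∀ x → IsInfimum poset (range poset (λ y → R x y ⇒ f y)) (g x)

    UpperApproximation : Rel (FuzzySet X) (c ⊔ ℓ₁ ⊔ ℓ₂ ⊔ a)
    UpperApproximation f g =
      ∀ x → IsSupremum poset (range poset (λ y → R x y ⊙ f y)) (g x)

    -- Hence each relation is the graph of a partial operator on fuzzy sets.
    lowerApproximation-unique : ∀ {f g h} → LowerApproximation f g →
                                LowerApproximation f h → ∀ x → g x ≈ h x
    lowerApproximation-unique p q x = infimum-unique poset (p x) (q x)

    upperApproximation-unique : ∀ {f g h} → UpperApproximation f g →
                                UpperApproximation f h → ∀ x → g x ≈ h x
    upperApproximation-unique p q x = supremum-unique poset (p x) (q x)

{-# OPTIONS --safe #-}
module Submission where

open import Defs
open import Algebra.Structures using (IsCommutativeMonoid)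
open import Data.Product.Base using (_×_; _,_)
open import Function.Bundles using (Equivalence)
import Relation.Binary.Reasoning.PartialOrder as PosetReasoning

-- Since `R x x ≈ ⊤`, the diagonal entries are `⊤ ⇒ ⊥`, which equals `⊥` by residuation, and
-- `⊤ ⊙ ⊤`, which equals `⊤`. A family that attains `⊥` has infimum `⊥`, and one that attains `⊤`
-- has supremum `⊤`.

module _ {c ℓ₁ ℓ₂} (A : Pocrim c ℓ₁ ℓ₂) where

  open Pocrim A
  open IsCommutativeMonoid isCommutativeMonoid using (∙-congˡ; identityʳ)
  open PosetReasoning poset

  -- Residuation turns the hypothesis into `l ⊙ t ≤ b`, where `t` acts as the unit.
  top-⇒-reflects-≤ : ∀ {l t b} → t ≈ ⊤ → l ≤ t ⇒ b → l ≤ b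
  top-⇒-reflects-≤ {l} {t} {b} t≈⊤ l≤t⇒b = begin
    l      ≈⟨ identityʳ l ⟨
    l ⊙ ⊤  ≈⟨ ∙-congˡ t≈⊤ ⟨
    l ⊙ t  ≤⟨ Equivalence.from (residuated l t b) l≤t⇒b ⟩
    b      ∎

  ⊙-top-reflects-≤ : ∀ {t u} → t ≈ ⊤ → t ⊙ ⊤ ≤ u → ⊤ ≤ u
  ⊙-top-reflects-≤ {t} {u} t≈⊤ t⊙⊤≤u = begin
    ⊤      ≈⟨ t≈⊤ ⟨
    t      ≈⟨ identityʳ t ⟨
    t ⊙ ⊤  ≤⟨ t⊙⊤≤u ⟩
    u      ∎

-- By reflexivity the entry at y = x is already the extreme element of M, so
-- the infimum and supremum exist without any appeal to completeness.
proposition4p1 : ∀ {c ℓ₁ ℓ₂ s a} (M : CompleteResiduatedMultilattice c ℓ₁ ℓ₂ s)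
    (𝒳 : FuzzyApproximationSpace M a) → IsReflexive M 𝒳 →
    LowerApproximation M 𝒳 (⇓ M) (⇓ M) × UpperApproximation M 𝒳 (⇑ M) (⇑ M)
proposition4p1 M 𝒳 R-refl =
    (λ x → (λ _ → minimum _)
         -- The lower bound is tested only against the diagonal entry `R x x ⇒ ⊥`.
         , λ lb → top-⇒-reflects-≤ pocrim (R-refl x) (lb (x , Eq.refl)))
  , (λ x → (λ _ → maximum _)
         , λ ub → ⊙-top-reflects-≤ pocrim (R-refl x) (ub (x , Eq.refl)))
  where open CompleteResiduatedMultilattice M
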